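{- Let $n\geq 1$. There is no non-trivial u-p-cycle $u=u_1\cdots u_N$ for $n$-permutations in which the $\Diamond$'s occur periodically with period $3$, i.e., in which $3$ divides $N$ and there is $r\in\{0,1,2\}$ such that for every position $i$, $u_i=\Diamond$ if and only if $i\equiv r\pmod 3$.
   Context: An $n$-permutation is a permutation of $\{1,\ldots,n\}$. For a word $w$ of distinct numbers, $\mathrm{red}(w)$ is obtained by replacing the $i$-th smallest letter by $i$. Let $\Diamond$ be a symbol not among the integers. A word $f=f_1\cdots f_n$ over the positive integers together with $\Diamond$, whose integer letters are pairwise distinct, covers an $n$-permutation $\pi$ if one can substitute real numbers for the occurrences of $\Diamond$ (independently) so that the resulting word has $n$ pairwise distinct entries and reduces to $\pi$; equivalently, $f_i<f_j\iff\pi_i<\pi_j$ for all positions $i,j$ holding integers. A u-p-cycle for $n$-permutations is a cyclic word $u_1\cdots u_N$, $N\geq n$, over this alphabet containing at least one $\Diamond$, indices read modulo $N$, such that each of its $N$ cyclic factors $u_iu_{i+1}\cdots u_{i+n-1}$ ($1\leq i\leq N$) has pairwise distinct integer letters and every $n$-permutation is covered by exactly one of these factors. It is trivial if all its letters are $\Diamond$. -}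

module Defs where

open import Data.Fin using (Fin; toℕ)
open import Data.Fin.Permutation using (Permutation′; _⟨$⟩ʳ_)
open import Data.Fin.Properties using (nonZeroIndex)
open import Data.Integer using (+_)
open import Data.List using (length; filter; allFin)
open import Data.Nat using (ℕ; suc; _+_; _≤_; _%_; NonZero)
open import Data.Nat.Divisibility using (_∣_)
open import Data.Nat.DivMod using (_mod_)
open import Data.Product using (∃-syntax; ∃!; _×_)
open import Data.Rational using (ℚ; _≤?_)
open import Data.Rational.Literals using (fromℤ)
open import Data.Unit using (⊤)
open import Function.Bundles using (_⇔_)
open import Function.Definitions using (Injective)
open import Relation.Binary.PropositionalEquality using (_≡_; _≢_)

data Letter : Set where
  ◇   : Letter
  int : (k : ℕ) .{{_ : NonZero k}} → Letter

Word : ℕ → Set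
Word n = Fin n → Letter

DistinctIntegers : ∀ {n} → Word n → Set
DistinctIntegers f = ∀ i j → f i ≢ ◇ → f i ≡ f j → i ≡ j

-- For pairwise distinct entries, the number of entries ≤ w i is the k such that
-- w i is the k-th smallest letter.
red : ∀ {n} → (Fin n → ℚ) → Fin n → ℕ
red w i = length (filter (λ j → w j ≤? w i) (allFin _))

Fills : Letter → ℚ → Set
Fills ◇       x = ⊤
Fills (int k) x = x ≡ fromℤ (+ k)

-- Rational substitutes suffice in place of real ones: only the relative order of
-- finitely many values matters, and ℚ is dense and unbounded.
-- A permutation of {1,…,n} is a bijection of Fin n with its values shifted by one.
Covers : ∀ {n} → Word n → Permutation′ n → Set
Covers {n} f π =
  ∃[ w ] Injective {A = Fin n} {B = ℚ} _≡_ _≡_ w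
       × (∀ i → Fills (f i) (w i))
       × (∀ i → red w i ≡ suc (toℕ (π ⟨$⟩ʳ i)))

factor : ∀ {N} (n : ℕ) → Word N → Fin N → Word n
factor {N} n u i j = u (_mod_ (toℕ i + toℕ j) N {{nonZeroIndex i}})

record IsUPCycle (n : ℕ) {N : ℕ} (u : Word N) : Set where
  field
    n≤N           : n ≤ N
    hasDiamond    : ∃[ i ] u i ≡ ◇
    distinct      : ∀ i → DistinctIntegers (factor n u i)
    coversExactly : ∀ (π : Permutation′ n) → ∃! _≡_ (λ i → Covers (factor n u i) π)

Trivial : ∀ {N} → Word N → Set
Trivial u = ∀ i → u i ≡ ◇

-- The position of i : Fin N in u₁⋯u_N is suc (toℕ i).
DiamondsWithPeriod3 : ∀ {N} → Word N → Set
DiamondsWithPeriod3 {N} u =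
  3 ∣ N × ∃[ r ] (∀ i → u i ≡ ◇ ⇔ suc (toℕ i) % 3 ≡ toℕ {3} r)

{-# OPTIONS --safe #-}

-- Say that a window has type c if its starting position is c modulo 3, and that a
-- position in a window has class c if the windows of type c carry ◇ there.  Fix one
-- window of each type, and form a word whose entries of class c are copied from the
-- fixed window of type c + 1.  Some window covers it, say of type c, and goes on
-- covering it when the entries of class c are overwritten by those of the fixed window
-- W of type c + 2.  Now the entries of classes c and c + 1 all come from W, so that W
-- covers the new word as well; but W does not have type c.

module Submission where

open import Defs
open import Data.Fin using (Fin; toℕ; fromℕ<; inject≤)
open import Data.Fin.Patterns using (0F; 1F; 2F)
open import Data.Fin.Permutation using (Permutation′; permutation; _⟨$⟩ʳ_)
open import Data.Fin.Properties using (any?; all?; injective⇒≤; toℕ-fromℕ<; toℕ-injective; toℕ<n; toℕ-inject≤; punchOut-injective; nonZeroIndex)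
open import Data.Integer using (+_)
open import Data.List using (List; []; _∷_; length; filter; allFin; map)
open import Data.List.Extrema.Nat using (max; max<v⁺; max≤v⁺; v≤max⁺)
open import Data.List.Membership.Propositional using (_∈_)
open import Data.List.Membership.Propositional.Properties using (∈-allFin; ∈-filter⁺; ∈-filter⁻; ∈-map⁺)
open import Data.List.Properties using (length-filter; filter-≐; filter-some; length-tabulate)
open import Data.List.Relation.Unary.All using (All)
open import Data.List.Relation.Unary.Any using (here; there)
open import Data.Nat using (ℕ; zero; suc; pred; _+_; _*_; _≤_; _<_; _%_; NonZero; >-nonZero; z≤n; s≤s; z<s; _≟_)
open import Data.Nat.DivMod using (_mod_; m%n<n; [m+kn]%n≡m%n; m<n⇒m%n≡m; %-distribˡ-+; m∣n⇒o%n%m≡o%m)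
open import Data.Nat.Divisibility using (_∣_; ∣⇒≤)
open import Data.Product using (∃-syntax; ∃!; _×_; _,_; proj₁; proj₂)
open import Data.Rational using (ℚ; fromℚᵘ)
open import Data.Rational.Literals using (fromℤ)
open import Data.Rational.Unnormalised using (mkℚᵘ; *<*; *≡*)
open import Data.Sum using (inj₂)
open import Data.Unit using (tt)
open import Function using (_∘_; case_of_; id)
open import Function.Bundles using (_⇔_; mk⇔; Equivalence)
open import Function.Definitions using (Injective)
open import Level using (Level)
open import Relation.Binary.Definitions using (tri<; tri≈; tri>)
open import Relation.Binary.PropositionalEquality using (_≡_; _≢_; refl; sym; trans; cong; cong₂; subst; subst₂; module ≡-Reasoning)
open import Relation.Nullary using (¬_; Dec; yes; no; contradiction)
open import Relation.Nullary.Decidable using (toWitness; _→-dec_; ¬?)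
open import Relation.Unary using (Pred; Decidable; _⊆_)
import Data.Fin as Fin
import Data.Fin.Properties as Fin
import Data.Integer as ℤ
import Data.Integer.Properties as ℤ
import Data.List.Relation.Unary.All as All
import Data.List.Relation.Unary.All.Properties as All
import Data.List.Relation.Unary.Any as Any
import Data.Nat.Properties as ℕ
import Data.Rational as ℚ
import Data.Rational.Properties as ℚ
import Data.Rational.Unnormalised.Properties as ℚᵘ

open Equivalence using (to; from)

private
  variable
    ℓ : Level
    A : Set ℓ
    n : ℕ

-- Counting in lists, and permutations of finite sets.

module _ {p q} {P : Pred A p} {Q : Pred A q}
         (P? : Decidable P) (Q? : Decidable Q) (P⊆Q : P ⊆ Q) where

  length-filter-mono-≤ : ∀ xs → length (filter P? xs) ≤ length (filter Q? xs)
  length-filter-mono-≤ [] = z≤n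
  length-filter-mono-≤ (x ∷ xs) with P? x | Q? x
  ... | yes px | yes qx = s≤s (length-filter-mono-≤ xs)
  ... | yes px | no ¬qx = contradiction (P⊆Q px) ¬qx
  ... | no ¬px | yes qx = ℕ.m≤n⇒m≤1+n (length-filter-mono-≤ xs)
  ... | no ¬px | no ¬qx = length-filter-mono-≤ xs

  length-filter-mono-< : ∀ {x xs} → x ∈ xs → Q x → ¬ P x →
                         length (filter P? xs) < length (filter Q? xs)
  length-filter-mono-< {x} {_ ∷ xs} (here refl) qx ¬px with P? x | Q? x
  ... | yes px | _      = contradiction px ¬px
  ... | no _   | no ¬qx = contradiction qx ¬qx
  ... | no _   | yes _  = s≤s (length-filter-mono-≤ xs)
  length-filter-mono-< {x} {y ∷ xs} (there x∈xs) qx ¬px with P? y | Q? y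
  ... | yes py | yes qy = s≤s (length-filter-mono-< x∈xs qx ¬px)
  ... | yes py | no ¬qy = contradiction (P⊆Q py) ¬qy
  ... | no ¬py | yes qy = ℕ.m<n⇒m<1+n (length-filter-mono-< x∈xs qx ¬px)
  ... | no ¬py | no ¬qy = length-filter-mono-< x∈xs qx ¬px

-- Pigeonhole principle: if `y` were missed, punching it out of the codomain would inject a set of
-- `suc n` elements into one of `n`.
injective⇒surjective : {f : Fin n → Fin n} → Injective _≡_ _≡_ f → ∀ y → ∃[ x ] f x ≡ y
injective⇒surjective {suc n} {f} f-inj y with any? (λ x → f x Fin.≟ y)
... | yes y∈f = y∈f
... | no  y∉f = contradiction (injective⇒≤ f-avoiding-y-inj) ℕ.1+n≰n
  where
  y≢f : ∀ x → y ≢ f x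
  y≢f x y≡fx = y∉f (x , sym y≡fx)

  f-avoiding-y-inj : Injective _≡_ _≡_ (λ x → Fin.punchOut (y≢f x))
  f-avoiding-y-inj eq = f-inj (punchOut-injective (y≢f _) (y≢f _) eq)

injective⇒permutation : (f : Fin n → Fin n) → Injective _≡_ _≡_ f → Permutation′ n
injective⇒permutation f f-inj = permutation f f⁻¹ f∘f⁻¹ (λ x → f-inj (f∘f⁻¹ (f x)))
  where
  f⁻¹ = proj₁ ∘ injective⇒surjective f-inj
  f∘f⁻¹ = proj₂ ∘ injective⇒surjective f-inj

-- Reduction of words of distinct rationals.

<⇒≱ : ∀ {p q} → p ℚ.< q → ¬ (q ℚ.≤ p)
<⇒≱ p<q q≤p = ℚ.<-irrefl refl (ℚ.<-≤-trans p<q q≤p)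

module _ (w : Fin n → ℚ) where

  red-mono-≤ : ∀ {i j} → w i ℚ.≤ w j → red w i ≤ red w j
  red-mono-≤ {i} {j} wi≤wj =
    length-filter-mono-≤ (λ k → w k ℚ.≤? w i) (λ k → w k ℚ.≤? w j)
      (λ wk≤wi → ℚ.≤-trans wk≤wi wi≤wj) (allFin _)

  red-mono-< : ∀ {i j} → w i ℚ.< w j → red w i < red w j
  red-mono-< {i} {j} wi<wj =
    length-filter-mono-< (λ k → w k ℚ.≤? w i) (λ k → w k ℚ.≤? w j)
      (λ wk≤wi → ℚ.≤-trans wk≤wi (ℚ.<⇒≤ wi<wj)) (∈-allFin j) ℚ.≤-refl (<⇒≱ wi<wj)

  red-cancel-< : ∀ {i j} → red w i < red w j → w i ℚ.< w j
  red-cancel-< redi<redj = ℚ.≰⇒> (λ wj≤wi → ℕ.<⇒≱ redi<redj (red-mono-≤ wj≤wi))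

  red-injective : Injective _≡_ _≡_ w → Injective _≡_ _≡_ (red w)
  red-injective w-inj {i} {j} eq with ℚ.<-cmp (w i) (w j)
  ... | tri< wi<wj _ _ = contradiction eq (ℕ.<⇒≢ (red-mono-< wi<wj))
  ... | tri≈ _ wi≡wj _ = w-inj wi≡wj
  ... | tri> _ _ wj<wi = contradiction (sym eq) (ℕ.<⇒≢ (red-mono-< wj<wi))

  red>0 : ∀ i → 0 < red w i
  red>0 i = filter-some _ (Any.map (λ where refl → ℚ.≤-refl) (∈-allFin i))

  red≤n : ∀ i → red w i ≤ n
  red≤n i = ℕ.≤-trans (length-filter _ (allFin n)) (ℕ.≤-reflexive (length-tabulate id))

-- As `v` is injective, trichotomy turns the implication into an equivalence, so both sides count
-- the same positions.
red-cong : (v w : Fin n → ℚ) → Injective _≡_ _≡_ v →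
           (∀ i j → v i ℚ.< v j → w i ℚ.< w j) → ∀ i → red w i ≡ red v i
red-cong v w v-inj v<⇒w< i =
  cong length (filter-≐ _ _ ((λ {j} → w≤⇒v≤ j) , (λ {j} → v≤⇒w≤ j)) (allFin _))
  where
  w≤⇒v≤ : ∀ j → w j ℚ.≤ w i → v j ℚ.≤ v i
  w≤⇒v≤ j wj≤wi = ℚ.≮⇒≥ (λ vi<vj → <⇒≱ (v<⇒w< i j vi<vj) wj≤wi)

  v≤⇒w≤ : ∀ j → v j ℚ.≤ v i → w j ℚ.≤ w i
  v≤⇒w≤ j vj≤vi with ℚ.<-cmp (v j) (v i)
  ... | tri< vj<vi _ _ = ℚ.<⇒≤ (v<⇒w< j i vj<vi)
  ... | tri≈ _ vj≡vi _ = ℚ.≤-reflexive (cong w (v-inj vj≡vi))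
  ... | tri> _ _ vi<vj = contradiction vj≤vi (<⇒≱ vi<vj)

mono-<⇒injective : {v w : Fin n → ℚ} → Injective _≡_ _≡_ v →
                   (∀ i j → v i ℚ.< v j → w i ℚ.< w j) → Injective _≡_ _≡_ w
mono-<⇒injective {v = v} v-inj v<⇒w< {i} {j} eq with ℚ.<-cmp (v i) (v j)
... | tri< vi<vj _ _ = contradiction eq (ℚ.<⇒≢ (v<⇒w< i j vi<vj))
... | tri≈ _ vi≡vj _ = v-inj vi≡vj
... | tri> _ _ vj<vi = contradiction (sym eq) (ℚ.<⇒≢ (v<⇒w< j i vj<vi))

record Standardisation (w : Fin n → ℚ) : Set where
  field
    perm     : Permutation′ n
    red≡perm : ∀ i → red w i ≡ suc (toℕ (perm ⟨$⟩ʳ i))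

-- The numbers `red w i` are distinct and lie between 1 and `n`; lowered by one, they give an
-- injection of `Fin n` into itself.
standardise : (w : Fin n → ℚ) → Injective _≡_ _≡_ w → Standardisation w
standardise {n} w w-inj = record
  { perm     = injective⇒permutation rank rank-injective
  ; red≡perm = red≡rank
  }
  where
  rank<n : ∀ i → pred (red w i) < n
  rank<n i = subst (_≤ n) (sym (ℕ.suc-pred (red w i) {{>-nonZero (red>0 w i)}})) (red≤n w i)

  rank : Fin n → Fin n
  rank i = fromℕ< (rank<n i)

  red≡rank : ∀ i → red w i ≡ suc (toℕ (rank i))
  red≡rank i = trans (sym (ℕ.suc-pred (red w i) {{>-nonZero (red>0 w i)}}))
                     (cong suc (sym (toℕ-fromℕ< (rank<n i))))

  rank-injective : Injective _≡_ _≡_ rank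
  rank-injective {i} {j} eq =
    red-injective w w-inj (trans (red≡rank i) (trans (cong (suc ∘ toℕ) eq) (sym (red≡rank j))))

-- Letters as numbers, and numbers as fractions.

-- The value 0 puts ◇ below all integer letters, which are positive, so that it never affects a
-- maximum.
value : Letter → ℕ
value ◇       = 0
value (int k) = k

value>0 : ∀ {x} → x ≢ ◇ → 0 < value x
value>0 {◇}               x≢◇ = contradiction refl x≢◇
value>0 {int zero {{()}}} x≢◇
value>0 {int (suc k)}     x≢◇ = z<s

value-injective : ∀ {x y} → x ≢ ◇ → y ≢ ◇ → value x ≡ value y → x ≡ y
value-injective {◇}             x≢◇ _   _    = contradiction refl x≢◇
value-injective {int _} {◇}     _   y≢◇ _    = contradiction refl y≢◇
value-injective {int _} {int _} _   _   refl = refl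

_≟◇ : ∀ x → Dec (x ≡ ◇)
◇     ≟◇ = yes refl
int _ ≟◇ = no λ ()

-- One direction of f_i < f_j ⇔ π_i < π_j suffices, as the integer letters are distinct.
Agrees : Word n → (Fin n → ℚ) → Set
Agrees f w = ∀ i j → f i ≢ ◇ → f j ≢ ◇ → value (f i) < value (f j) → w i ℚ.< w j

-- This is k/(d + 1), since `mkℚᵘ` stores the denominator minus one.
ratio : ℕ → ℕ → ℚ
ratio d k = fromℚᵘ (mkℚᵘ (+ k) d)

ratio-mono-< : ∀ d {k l} → k < l → ratio d k ℚ.< ratio d l
ratio-mono-< d {k} {l} k<l =
  ℚ.toℚᵘ-cancel-<
    (ℚᵘ.<-respˡ-≃ (ℚᵘ.≃-sym (ℚ.toℚᵘ-fromℚᵘ (mkℚᵘ (+ k) d)))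
      (ℚᵘ.<-respʳ-≃ (ℚᵘ.≃-sym (ℚ.toℚᵘ-fromℚᵘ (mkℚᵘ (+ l) d)))
        (*<* (ℤ.*-monoʳ-<-pos (+ suc d) (ℤ.+<+ k<l)))))

ratio-multiple : ∀ d k → ratio d (k * suc d) ≡ fromℤ (+ k)
ratio-multiple d k =
  trans (ℚ.fromℚᵘ-cong {mkℚᵘ (+ (k * suc d)) d} {mkℚᵘ (+ k) 0}
          (*≡* (trans (ℤ.*-identityʳ _) (ℤ.pos-* k (suc d)))))
        (ℚ.fromℚᵘ-toℚᵘ (fromℤ (+ k)))

fromℤ-mono-< : ∀ {k l} → k < l → fromℤ (+ k) ℚ.< fromℤ (+ l)
fromℤ-mono-< k<l = ℚ.*<* (ℤ.*-monoʳ-<-pos (+ 1) (ℤ.+<+ k<l))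

fromℤ-injective : ∀ {k l} → fromℤ (+ k) ≡ fromℤ (+ l) → k ≡ l
fromℤ-injective refl = refl

Fills⇒≡ : ∀ {x q} → x ≢ ◇ → Fills x q → q ≡ fromℤ (+ value x)
Fills⇒≡ {◇}     x≢◇ _ = contradiction refl x≢◇
Fills⇒≡ {int _} _   q≡k = q≡k

≡⇒Fills : ∀ {x q} → (x ≢ ◇ → q ≡ fromℤ (+ value x)) → Fills x q
≡⇒Fills {◇}     _ = tt
≡⇒Fills {int _} q≡k = q≡k λ ()

-- Covering as agreement of relative orders.

module _ {w : Fin n → ℚ} (std : Standardisation w) (f : Word n) where
  open Standardisation std

  -- The covering word `v` contains the integer letters themselves, and it is ordered like `w`
  -- because both have the same `red`.
  Covers⇒Agrees : Covers f perm → Agrees f w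
  Covers⇒Agrees (v , _ , fills , red-v) i j fi≢◇ fj≢◇ fi<fj =
    red-cancel-< w (subst₂ _<_ (red-v≡red-w i) (red-v≡red-w j) (red-mono-< v vi<vj))
    where
    red-v≡red-w : ∀ k → red v k ≡ red w k
    red-v≡red-w k = trans (red-v k) (sym (red≡perm k))

    vi<vj : v i ℚ.< v j
    vi<vj = subst₂ ℚ._<_ (sym (Fills⇒≡ fi≢◇ (fills i))) (sym (Fills⇒≡ fj≢◇ (fills j)))
                   (fromℤ-mono-< fi<fj)

  module _ (w-inj : Injective _≡_ _≡_ w) (dist : DistinctIntegers f) (agrees : Agrees f w) where

    below : Fin n → List (Fin n)
    below i = filter (λ j → w j ℚ.≤? w i) (allFin n)

    floor : Fin n → ℕ
    floor i = max 0 (map (value ∘ f) (below i))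

    All-below : ∀ {P : Pred ℕ ℓ} i → (∀ j → w j ℚ.≤ w i → P (value (f j))) →
                All P (map (value ∘ f) (below i))
    All-below i p = All.map⁺ (All.tabulate (λ {j} j∈ → p j (proj₂ (∈-filter⁻ _ {xs = allFin n} j∈))))

    value≤floor : ∀ {i j} → w j ℚ.≤ w i → value (f j) ≤ floor i
    value≤floor {i} {j} wj≤wi =
      v≤max⁺ 0 _ (inj₂ (Any.map ℕ.≤-reflexive
        (∈-map⁺ (value ∘ f) (∈-filter⁺ (λ k → w k ℚ.≤? w i) (∈-allFin j) wj≤wi))))

    floor-mono-≤ : ∀ {i j} → w i ℚ.≤ w j → floor i ≤ floor j
    floor-mono-≤ {i} wi≤wj =
      max≤v⁺ z≤n (All-below i (λ k wk≤wi → value≤floor (ℚ.≤-trans wk≤wi wi≤wj)))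

    value-mono-≤ : ∀ {i j} → f j ≢ ◇ → w i ℚ.≤ w j → value (f i) ≤ value (f j)
    value-mono-≤ {i} {j} fj≢◇ wi≤wj with f i ≟◇
    ... | yes fi≡◇ = subst (λ x → value x ≤ value (f j)) (sym fi≡◇) z≤n
    ... | no  fi≢◇ = ℕ.≮⇒≥ (λ fj<fi → <⇒≱ (agrees j i fj≢◇ fi≢◇ fj<fi) wi≤wj)

    -- Agreement alone leaves room for equality; equal integer letters, however, would stand at the
    -- same position.
    value-mono-< : ∀ {i j} → f j ≢ ◇ → w i ℚ.< w j → value (f i) < value (f j)
    value-mono-< {i} {j} fj≢◇ wi<wj with f i ≟◇
    ... | yes fi≡◇ = subst (λ x → value x < value (f j)) (sym fi≡◇) (value>0 fj≢◇)
    ... | no  fi≢◇ = ℕ.≤∧≢⇒< (value-mono-≤ fj≢◇ (ℚ.<⇒≤ wi<wj))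
      (λ eq → ℚ.<-irrefl (cong w (dist i j fi≢◇ (value-injective fi≢◇ fj≢◇ eq))) wi<wj)

    floor≡value : ∀ {i} → f i ≢ ◇ → floor i ≡ value (f i)
    floor≡value {i} fi≢◇ = ℕ.≤-antisym
      (max≤v⁺ z≤n (All-below i (λ _ → value-mono-≤ fi≢◇)))
      (value≤floor ℚ.≤-refl)

    floor<value : ∀ {i j} → f j ≢ ◇ → w i ℚ.< w j → floor i < value (f j)
    floor<value {i} fj≢◇ wi<wj =
      max<v⁺ (value>0 fj≢◇)
        (All-below i (λ _ wk≤wi → value-mono-< fj≢◇ (ℚ.≤-<-trans wk≤wi wi<wj)))

    -- This is a numerator over `suc n`. Ranks run from 1 to `n`, so a ◇ lands strictly between two
    -- consecutive integers, while 0 leaves an integer letter in place.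
    frac : Fin n → ℕ
    frac i with f i ≟◇
    ... | yes _ = red w i
    ... | no  _ = 0

    frac-int : ∀ {i} → f i ≢ ◇ → frac i ≡ 0
    frac-int {i} fi≢◇ with f i ≟◇
    ... | yes fi≡◇ = contradiction fi≡◇ fi≢◇
    ... | no  _    = refl

    frac<1+n : ∀ i → frac i < suc n
    frac<1+n i with f i ≟◇
    ... | yes _ = s≤s (red≤n w i)
    ... | no  _ = z<s

    frac-mono-< : ∀ {i j} → f j ≡ ◇ → w i ℚ.< w j → frac i < frac j
    frac-mono-< {i} {j} fj≡◇ wi<wj with f i ≟◇ | f j ≟◇
    ... | _     | no fj≢◇ = contradiction fj≡◇ fj≢◇
    ... | yes _ | yes _   = red-mono-< w wi<wj
    ... | no _  | yes _   = red>0 w j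

    -- A ◇ is filled by the largest integer letter it has to exceed (0 if there is
    -- none) plus a fraction below 1 that increases with its rank.
    scaled : Fin n → ℕ
    scaled i = frac i + floor i * suc n

    filling : Fin n → ℚ
    filling i = ratio n (scaled i)

    open ℕ.≤-Reasoning

    scaled-mono-< : ∀ i j → w i ℚ.< w j → scaled i < scaled j
    -- If `f j` is ◇, the floor may stay the same but the fraction grows. If it is an integer, the
    -- floor grows by at least one, which outweighs any fraction.
    scaled-mono-< i j wi<wj = case f j ≟◇ of λ where
      (yes fj≡◇) → ℕ.+-mono-<-≤ (frac-mono-< fj≡◇ wi<wj)
                     (ℕ.*-monoˡ-≤ (suc n) (floor-mono-≤ (ℚ.<⇒≤ wi<wj)))
      (no fj≢◇) → begin-strict
        frac i + floor i * suc n  <⟨ ℕ.+-monoˡ-< (floor i * suc n) (frac<1+n i) ⟩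
        suc (floor i) * suc n     ≤⟨ ℕ.*-monoˡ-≤ (suc n) (floor<value fj≢◇ wi<wj) ⟩
        value (f j) * suc n       ≡⟨ cong (_* suc n) (floor≡value fj≢◇) ⟨
        floor j * suc n           ≤⟨ ℕ.m≤n+m _ (frac j) ⟩
        frac j + floor j * suc n  ∎

    filling-mono-< : ∀ i j → w i ℚ.< w j → filling i ℚ.< filling j
    filling-mono-< i j wi<wj = ratio-mono-< n (scaled-mono-< i j wi<wj)

    filling-injective : Injective _≡_ _≡_ filling
    filling-injective = mono-<⇒injective w-inj filling-mono-<

    filling-int : ∀ i → f i ≢ ◇ → filling i ≡ fromℤ (+ value (f i))
    filling-int i fi≢◇ =
      trans (cong₂ (λ a b → ratio n (a + b * suc n)) (frac-int fi≢◇) (floor≡value fi≢◇))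
            (ratio-multiple n (value (f i)))

    Agrees⇒Covers : Covers f perm
    Agrees⇒Covers =
      filling , filling-injective , (λ i → ≡⇒Fills (filling-int i)) ,
      (λ i → trans (red-cong w filling w-inj filling-mono-< i) (red≡perm i))

-- This is what permits overwriting: entries at the ◇'s of `f` may change freely.
Agrees-cong : ∀ {f : Word n} {v w} → (∀ i → f i ≢ ◇ → v i ≡ w i) → Agrees f v → Agrees f w
Agrees-cong v≡w agrees i j fi≢◇ fj≢◇ fi<fj =
  subst₂ ℚ._<_ (v≡w i fi≢◇) (v≡w j fj≢◇) (agrees i j fi≢◇ fj≢◇ fi<fj)

-- Choosing a source window for each class modulo 3.

next prev : Fin 3 → Fin 3
next 0F = 1F
next 1F = 2F
next 2F = 0F
prev 0F = 2F
prev 1F = 0F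
prev 2F = 1F

next≢id : ∀ c → next c ≢ c
next≢id 0F ()
next≢id 1F ()
next≢id 2F ()

prev≢id : ∀ c → prev c ≢ c
prev≢id 0F ()
prev≢id 1F ()
prev≢id 2F ()

-- The sources after overwriting: class `c` switches to type c + 2, which is `prev c`, and the other
-- classes keep theirs.
redirect : Fin 3 → Fin 3 → Fin 3
redirect c d with d Fin.≟ c
... | yes _ = prev c
... | no  _ = next d

redirect≢id : ∀ c d → redirect c d ≢ d
redirect≢id c d with d Fin.≟ c
... | yes refl = prev≢id d
... | no  _    = next≢id d

redirect-next : ∀ c d → d ≢ c → redirect c d ≡ next d
redirect-next c d d≢c with d Fin.≟ c
... | yes d≡c = contradiction d≡c d≢c
... | no  _   = refl

-- Class `c` is sent to `prev c` by the overwriting, and class c + 1 by `next`, since c + 2 ≡ c - 1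
-- modulo 3.
redirect-prev : ∀ c d → d ≢ prev c → redirect c d ≡ prev c
redirect-prev = toWitness {a? = all? λ c → all? λ d →
  ¬? (d Fin.≟ prev c) →-dec (redirect c d Fin.≟ prev c)} tt

-- Mixing the entries of three fixed windows.

module _ {N} (window : Fin N → Word n) (distinct : ∀ i → DistinctIntegers (window i))
         (type : Fin N → Fin 3) (start : Fin 3 → Fin N) (type-start : ∀ c → type (start c) ≡ c)
         (class : Fin n → Fin 3) (window≡◇ : ∀ i j → window i j ≡ ◇ ⇔ class j ≡ type i) where

  letter : Fin 3 → Fin n → Letter
  letter c = window (start c)

  letter≢◇ : ∀ {c j} → class j ≢ c → letter c j ≢ ◇
  letter≢◇ {c} {j} j≢c eq = j≢c (trans (to (window≡◇ (start c) j) eq) (type-start c))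

  class≢type : ∀ {i j} → window i j ≢ ◇ → class j ≢ type i
  class≢type {i} {j} ≢◇ eq = ≢◇ (from (window≡◇ i j) eq)

  -- Entries copied from different windows differ modulo 3.
  code : Fin 3 → Fin n → ℕ
  code c j = toℕ c + value (letter c j) * 3

  -- Here `ρ` sends a class to the type of the fixed window that supplies its entries. If `ρ` has no
  -- fixed point, every copied entry is an integer letter.
  mix : (Fin 3 → Fin 3) → Fin n → ℚ
  mix ρ j = fromℤ (+ code (ρ (class j)) j)

  code-type : ∀ {c d i j} → code c i ≡ code d j → c ≡ d
  code-type {c} {d} {i} {j} eq =
    toℕ-injective (trans (sym (code%3 c i)) (trans (cong (_% 3) eq) (code%3 d j)))
    where
    code%3 : ∀ c j → code c j % 3 ≡ toℕ c
    code%3 c j = trans ([m+kn]%n≡m%n (toℕ c) (value (letter c j)) 3) (m<n⇒m%n≡m (toℕ<n c))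

  -- Equal codes have the same residue modulo 3 and hence the same source window, whose integer
  -- letters are distinct.
  mix-injective : ∀ {ρ} → (∀ c → ρ c ≢ c) → Injective _≡_ _≡_ (mix ρ)
  mix-injective {ρ} ρ≢id {i} {j} eq =
    same (letter≢◇ (ρ≢id (class i) ∘ sym)) (letter≢◇ (ρ≢id (class j) ∘ sym))
         (code-type {i = i} {j} codes) codes
    where
    codes = fromℤ-injective eq

    same : ∀ {c d} → letter c i ≢ ◇ → letter d j ≢ ◇ → c ≡ d → code c i ≡ code d j → i ≡ j
    same {c} i≢◇ j≢◇ refl codes = distinct (start c) i j i≢◇
      (value-injective i≢◇ j≢◇ (ℕ.*-cancelʳ-≡ _ _ 3 (ℕ.+-cancelˡ-≡ (toℕ c) _ _ codes)))

  -- The integer letters of this window stand at classes other than `c`, where the mix copies this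
  -- very window; `code c` preserves their order.
  mix-agrees : ∀ {ρ} c → (∀ d → d ≢ c → ρ d ≡ c) → Agrees (letter c) (mix ρ)
  mix-agrees {ρ} c ρ≡c i j i≢◇ j≢◇ fi<fj =
    fromℤ-mono-< (subst₂ (λ d e → code d i < code e j) (sym (source i≢◇)) (sym (source j≢◇))
      (ℕ.+-monoʳ-< (toℕ c) (ℕ.*-monoˡ-< 3 fi<fj)))
    where
    source : ∀ {k} → letter c k ≢ ◇ → ρ (class k) ≡ c
    source {k} k≢◇ = ρ≡c (class k) (λ k≡c → class≢type k≢◇ (trans k≡c (sym (type-start c))))

  not-uniquely-covering : ¬ (∀ π → ∃! _≡_ (λ i → Covers (window i) π))
  not-uniquely-covering unique =
    -- Both windows cover `π′` and so coincide, although their types are `prev c` and `c`.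
    prev≢id c (trans (sym (type-start (prev c)))
                     (cong type (trans (sym (uniq fixed-covers)) (uniq found-covers))))
    where
    std = standardise (mix next) (mix-injective next≢id)
    found = unique (Standardisation.perm std)
    i = proj₁ found
    c = type i

    v = mix (redirect c)
    v-inj : Injective _≡_ _≡_ v
    v-inj = mix-injective (redirect≢id c)
    std′ = standardise v v-inj
    π′ = Standardisation.perm std′

    uniq : ∀ {k} → Covers (window k) π′ → proj₁ (unique π′) ≡ k
    uniq = proj₂ (proj₂ (unique π′))

    found-covers : Covers (window i) π′
    found-covers = Agrees⇒Covers std′ (window i) v-inj (distinct i)
      (Agrees-cong
        -- The two mixes differ only at class `c`, where window `i` carries ◇.
        (λ j j≢◇ → cong (λ d → fromℤ (+ code d j)) (sym (redirect-next c (class j) (class≢type j≢◇))))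
        (Covers⇒Agrees std (window i) (proj₁ (proj₂ found))))

    fixed-covers : Covers (letter (prev c)) π′
    fixed-covers = Agrees⇒Covers std′ (letter (prev c)) v-inj (distinct (start (prev c)))
      (mix-agrees (prev c) (redirect-prev c))

-- Positions of the ◇'s in the factors of the cycle.

-- Modulo 3, the solution of 1 + i + j ≡ r for i is r − 1 − j ≡ r + 2 + 2j.
residue⇔ : ∀ (a b r : Fin 3) → suc (toℕ a + toℕ b) % 3 ≡ toℕ r ⇔ (toℕ r + 2 + toℕ b * 2) mod 3 ≡ a
residue⇔ a b r = mk⇔ (⇒class a b r) (class⇒ a b r)
  where
  ⇒class : ∀ (a b r : Fin 3) → suc (toℕ a + toℕ b) % 3 ≡ toℕ r → (toℕ r + 2 + toℕ b * 2) mod 3 ≡ a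
  ⇒class = toWitness {a? = all? λ a → all? λ b → all? λ r → (_ ≟ _) →-dec (_ Fin.≟ _)} tt

  class⇒ : ∀ (a b r : Fin 3) → (toℕ r + 2 + toℕ b * 2) mod 3 ≡ a → suc (toℕ a + toℕ b) % 3 ≡ toℕ r
  class⇒ = toWitness {a? = all? λ a → all? λ b → all? λ r → (_ Fin.≟ _) →-dec (_ ≟ _)} tt

-- Wrapping around the cycle preserves residues modulo 3 because 3 divides `N`.
suc-+-mod : ∀ {N} .{{_ : NonZero N}} → 3 ∣ N → ∀ i j →
            suc (toℕ ((i + j) mod N)) % 3 ≡ suc (toℕ (i mod 3) + toℕ (j mod 3)) % 3
suc-+-mod {N} 3∣N i j = begin
  suc (toℕ ((i + j) mod N)) % 3                ≡⟨ cong (λ m → suc m % 3) (toℕ-fromℕ< (m%n<n (i + j) N)) ⟩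
  (1 + (i + j) % N) % 3                        ≡⟨ %-distribˡ-+ 1 ((i + j) % N) 3 ⟩
  (1 + (i + j) % N % 3) % 3                    ≡⟨ cong (λ m → (1 + m) % 3) (m∣n⇒o%n%m≡o%m 3 N (i + j) 3∣N) ⟩
  (1 + (i + j) % 3) % 3                        ≡⟨ cong (λ m → (1 + m) % 3) (%-distribˡ-+ i j 3) ⟩
  (1 + (i % 3 + j % 3) % 3) % 3                ≡⟨ %-distribˡ-+ 1 (i % 3 + j % 3) 3 ⟨
  suc (i % 3 + j % 3) % 3                      ≡⟨ cong₂ (λ a b → suc (a + b) % 3) (toℕ-fromℕ< (m%n<n i 3)) (toℕ-fromℕ< (m%n<n j 3)) ⟨
  suc (toℕ (i mod 3) + toℕ (j mod 3)) % 3      ∎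
  where open ≡-Reasoning

theorem3 : ∀ (n : ℕ) → 1 ≤ n → ¬ (∃[ N ] ∃[ u ] (IsUPCycle n {N} u × ¬ Trivial u × DiamondsWithPeriod3 u))
theorem3 n _ (N , u , cycle , _ , 3∣N , r , period) =
  not-uniquely-covering (factor n u) distinct type start type-start class factor≡◇ coversExactly
  where
  open IsUPCycle cycle

  -- The position of some ◇ shows that `N` is nonzero; with `3∣N` this gives `3≤N`, so windows of
  -- all three types exist.
  instance
    N≢0 : NonZero N
    N≢0 = nonZeroIndex (proj₁ hasDiamond)

  3≤N : 3 ≤ N
  3≤N = ∣⇒≤ 3∣N

  type : Fin N → Fin 3
  type i = toℕ i mod 3

  start : Fin 3 → Fin N
  start c = inject≤ c 3≤N

  type-start : ∀ c → type (start c) ≡ c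
  type-start c = toℕ-injective (trans (toℕ-fromℕ< (m%n<n (toℕ (start c)) 3))
    (trans (cong (_% 3) (toℕ-inject≤ c 3≤N)) (m<n⇒m%n≡m (toℕ<n c))))

  class : Fin n → Fin 3
  class j = (toℕ r + 2 + toℕ (toℕ j mod 3) * 2) mod 3

  factor≡◇ : ∀ i j → factor n u i j ≡ ◇ ⇔ class j ≡ type i
  factor≡◇ i j = mk⇔
    (λ eq → to residues (trans (sym position) (to (period _) eq)))
    (λ eq → from (period _) (trans position (from residues eq)))
    where
    residues = residue⇔ (type i) (toℕ j mod 3) r
    position = suc-+-mod 3∣N (toℕ i) (toℕ j)
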